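{- Let $N$ be an odd composite number with prime factorization $N=\prod_{i=1}^r p_i^{e_i}$, where the $p_i$ are distinct primes and $e_i\ge 1$. Then the probability that the Miller–Rabin test on $N$ fails (i.e. outputs PRIME) is at most $$\frac{1}{2^{r-1}\cdot \prod_{i=1}^r p_i^{e_i-1}}.$$
   Context: The Miller–Rabin test on an integer $N>1$: if $N=2$ output PRIME; if $N$ is even output COMPOSITE; otherwise choose $a$ uniformly at random among the integers in $[1,N-1]$, write $N-1=2^s t$ with $s,t$ nonnegative integers and $t$ odd, and output PRIME if $a^t\equiv 1\pmod N$ or $a^{2^i t}\equiv -1 \pmod N$ for some integer $i$ with $0\le i\le s-1$; otherwise output COMPOSITE. -}

module Defs where

open import Data.Nat using (ℕ; zero; suc; _+_; _*_; _∸_; _^_; _<_; _≤_; NonZero; _≟_)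
open import Data.Nat.DivMod using (_%_)
open import Data.Nat.Properties using (anyUpTo?)
open import Data.Product using (∃; _×_; _,_; proj₁; proj₂)
open import Data.Sum using (_⊎_)
open import Data.List using (List; length; filter; map; upTo)
open import Data.Nat.ListAction using (product)
open import Relation.Binary.PropositionalEquality using (_≡_)
open import Relation.Nullary.Decidable using (Dec; _⊎-dec_)

-- Miller–Rabin "liar" condition for base a, with N - 1 = 2^s * t (t odd):
--   a^t ≡ 1 (mod N)  or  a^(2^i t) ≡ -1 (mod N) for some 0 ≤ i ≤ s-1.
-- Since N > 1 here, "≡ 1 (mod N)" is "(·) % N ≡ 1" and
-- "≡ -1 (mod N)" is "(·) % N ≡ N ∸ 1".
MRPrime : (N s t a : ℕ) → .{{NonZero N}} → Set
MRPrime N s t a =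
  ((a ^ t) % N ≡ 1) ⊎ (∃ λ i → i < s × ((a ^ (2 ^ i * t)) % N ≡ N ∸ 1))

MRPrime? : (N s t : ℕ) → .{{_ : NonZero N}} → (a : ℕ) → Dec (MRPrime N s t a)
MRPrime? N s t a =
  ((a ^ t) % N ≟ 1) ⊎-dec anyUpTo? (λ i → (a ^ (2 ^ i * t)) % N ≟ N ∸ 1) s

-- The candidate bases: the integers 1, 2, ..., N-1.
bases : ℕ → List ℕ
bases N = map suc (upTo (N ∸ 1))

-- Number of bases a ∈ [1, N-1] for which the test outputs PRIME.
-- The failure probability of the test on odd N is  #liars N s t / (N - 1).
#liars : (N s t : ℕ) → .{{NonZero N}} → ℕ
#liars N s t = length (filter (MRPrime? N s t) (bases N))

-- Product over a factorisation given as a list of (p , e) pairs.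
primePowerProduct : List (ℕ × ℕ) → ℕ
primePowerProduct ps = product (map (λ pe → proj₁ pe ^ proj₂ pe) ps)

-- ∏ p_i^(e_i - 1)
reducedProduct : List (ℕ × ℕ) → ℕ
reducedProduct ps = product (map (λ pe → proj₁ pe ^ (proj₂ pe ∸ 1)) ps)

{-# OPTIONS --safe #-}
module Submission where

-- Let k be the largest i < s for which some base b has b^(2^i t) ≡ -1 (mod N) (i = 0 qualifies,
-- with b = N - 1); fix such a base B and put m = 2^k t. Then 2m ∣ N - 1, and every liar a satisfies
-- a^m ≡ ±1 (mod N). For each prime power p^e ∥ N choose a sign σ and some c < p^(e-1); by the Chinese
-- remainder theorem there is Y with Y ≡ 1 + cp or Y ≡ B(1 + cp) (mod p^e), according to σ, for every
-- p. The map (a, choices) ↦ aY (mod N), restricted to σ = + at the first prime, is injective: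
-- (aY)^(mN) ≡ ±1 (mod p^e) reveals the product of the sign of a^m and σ; after cancelling B, raising
-- to the power N - 1 removes a and leaves (1 + cp)^(N-1), which determines c because the 1 + cp are
-- distinct p^(e-1)-th roots of unity mod p^e and p ∤ N - 1; then a is determined modulo every p^e,
-- hence modulo N. As aY is never divisible by N, the domain, of size #liars · 2^(r-1) · ∏ p^(e-1),
-- injects into [1, N - 1].

open import Data.Nat.Base as ℕ using (ℕ; zero; suc; NonZero; _<_; _≤_)
import Data.Nat.Properties as ℕ
import Data.Nat.Divisibility as ℕ
open import Data.Nat.ListAction using (product)
import Data.Integer.Properties as ℤ
open import Data.Sign.Base as Sign using (Sign)
import Data.Sign.Properties as Sign
open import Data.Fin.Base using (Fin; zero; suc; toℕ; fromℕ<)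
open import Data.Product using (∃; _×_; _,_; proj₁; proj₂; uncurry)
open import Data.Sum using (_⊎_; inj₁; inj₂; [_,_]′)
open import Data.Empty using (⊥-elim)
open import Data.List.Base using (List; []; _∷_; map; length; lookup; filter)
open import Data.List.Relation.Unary.All as All using (All; []; _∷_)
import Data.List.Relation.Unary.All.Properties as All
open import Data.List.Relation.Unary.AllPairs using (AllPairs; []; _∷_)
import Data.List.Relation.Unary.AllPairs.Properties as AllPairs
open import Data.List.Membership.Propositional.Properties using (∈-lookup; ∈-filter⁻; ∈-map⁻; ∈-upTo⁻)
open import Function.Base using (_on_; _∘_)
open import Relation.Nullary using (¬_; yes; no)
open import Relation.Unary using (Decidable)
open import Relation.Binary.PropositionalEquality
  using (_≡_; _≢_; refl; sym; trans; cong; cong₂; subst; subst₂; module ≡-Reasoning)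

module Arithmetic where

  open import Data.Nat.Tactic.RingSolver using (solve-∀)

  n∣m<n⇒m≡0 : ∀ {m n} → n ℕ.∣ m → m < n → m ≡ 0
  n∣m<n⇒m≡0 {zero}  _   _   = refl
  n∣m<n⇒m≡0 {suc m} n∣m m<n = ⊥-elim (ℕ.<⇒≱ m<n (ℕ.∣⇒≤ n∣m))

  2∣n⊎2∣1+n : ∀ n → 2 ℕ.∣ n ⊎ 2 ℕ.∣ suc n
  2∣n⊎2∣1+n zero    = inj₁ (2 ℕ.∣0)
  2∣n⊎2∣1+n (suc n) = [ (λ 2∣n → inj₂ (ℕ.∣m∣n⇒∣m+n ℕ.∣-refl 2∣n)) , inj₁ ]′ (2∣n⊎2∣1+n n)

  2^[1+i+d]*t : ∀ i d t → 2 ℕ.^ (suc i ℕ.+ d) ℕ.* t ≡ 2 ℕ.^ i ℕ.* t ℕ.* 2 ℕ.* 2 ℕ.^ d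
  2^[1+i+d]*t i d t = trans (cong (ℕ._* t) (ℕ.^-distribˡ-+-* 2 (suc i) d)) (lemma (2 ℕ.^ i) (2 ℕ.^ d) t)
    where
    lemma : ∀ x y t → 2 ℕ.* x ℕ.* y ℕ.* t ≡ x ℕ.* t ℕ.* 2 ℕ.* y
    lemma = solve-∀

  product-map-2* : ∀ {A : Set} (f : A → ℕ) xs →
                   product (map (λ x → 2 ℕ.* f x) xs) ≡ 2 ℕ.^ length xs ℕ.* product (map f xs)
  product-map-2* f []       = refl
  product-map-2* f (x ∷ xs) =
    trans (cong (2 ℕ.* f x ℕ.*_) (product-map-2* f xs)) (lemma (f x) (2 ℕ.^ length xs) (product (map f xs)))
    where
    lemma : ∀ a b c → 2 ℕ.* a ℕ.* (b ℕ.* c) ≡ 2 ℕ.* b ℕ.* (a ℕ.* c)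
    lemma = solve-∀

  greatest-below : ∀ {P : ℕ → Set} → Decidable P → ∀ {i n} → i < n → P i →
                   ∃ λ k → k < n × P k × (∀ {j} → k < j → j < n → ¬ P j)
  greatest-below P? {i} {suc n} i<1+n Pi with P? n
  ... | yes Pn = n , ℕ.n<1+n n , Pn , λ n<j j<1+n _ → ℕ.<⇒≱ n<j (ℕ.≤-pred j<1+n)
  ... | no ¬Pn with ℕ.m≤n⇒m<n∨m≡n (ℕ.≤-pred i<1+n)
  ...   | inj₂ refl = ⊥-elim (¬Pn Pi)
  ...   | inj₁ i<n with k , k<n , Pk , greatest ← greatest-below P? i<n Pi =
    k , ℕ.m<n⇒m<1+n k<n , Pk ,
    λ k<j j<1+n → [ greatest k<j , (λ { refl → ¬Pn }) ]′ (ℕ.m≤n⇒m<n∨m≡n (ℕ.≤-pred j<1+n))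

module Congruence where

  open import Data.Nat.Coprimality using (Coprime; coprime⇒gcd≡1)
  open import Data.Nat.LCM using (lcm; lcm-least; gcd*lcm)
  open import Data.Nat.DivMod using (_%_)
  open import Data.Integer.Base using (ℤ; +_; _+_; _-_; _*_; -_; _^_; 0ℤ; 1ℤ; -1ℤ; ∣_∣; _%ℕ_; _/ℕ_)
  open import Data.Integer.DivMod using (n%ℕd<d; a≡a%ℕn+[a/ℕn]*n)
  open import Data.Integer.Divisibility.Signed
    using (_∣_; divides; ∣m∣n⇒∣m+n; ∣m⇒∣-m; ∣n⇒∣m*n; ∣m⇒∣m*n; ∣-trans; ∣ᵤ⇒∣; ∣⇒∣ᵤ;
           *-cancelʳ-∣)
  open import Data.Integer.Tactic.RingSolver using (solve-∀)
  open import Data.Fin.Properties using (toℕ-fromℕ<)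
  open import Relation.Binary.Bundles using (Setoid)
  open import Relation.Binary.Structures using (IsEquivalence)
  import Relation.Binary.Reasoning.Setoid as SetoidReasoning
  open Arithmetic using (n∣m<n⇒m≡0)

  infix 4 _≡_mod_
  record _≡_mod_ (x y : ℤ) (n : ℕ) : Set where
    constructor ≡-mod
    field modulus∣difference : + n ∣ x - y

  module _ {n : ℕ} where

    ≡-mod-reflexive : ∀ {x y} → x ≡ y → x ≡ y mod n
    ≡-mod-reflexive {x} refl = ≡-mod (divides 0ℤ (trans (ℤ.+-inverseʳ x) (sym (ℤ.*-zeroˡ (+ n)))))

    ≡-mod-refl : ∀ {x} → x ≡ x mod n
    ≡-mod-refl = ≡-mod-reflexive refl

    ≡-mod-sym : ∀ {x y} → x ≡ y mod n → y ≡ x mod n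
    ≡-mod-sym {x} {y} (≡-mod n∣x-y) = ≡-mod (subst (+ n ∣_) (lemma x y) (∣m⇒∣-m n∣x-y))
      where
      lemma : ∀ x y → - (x - y) ≡ y - x
      lemma = solve-∀

    ≡-mod-trans : ∀ {x y z} → x ≡ y mod n → y ≡ z mod n → x ≡ z mod n
    ≡-mod-trans {x} {y} {z} (≡-mod n∣x-y) (≡-mod n∣y-z) =
      ≡-mod (subst (+ n ∣_) (lemma x y z) (∣m∣n⇒∣m+n n∣x-y n∣y-z))
      where
      lemma : ∀ x y z → (x - y) + (y - z) ≡ x - z
      lemma = solve-∀

    ≡-mod-isEquivalence : IsEquivalence (λ x y → x ≡ y mod n)
    ≡-mod-isEquivalence = record { refl = ≡-mod-refl ; sym = ≡-mod-sym ; trans = ≡-mod-trans }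

  ≡-mod-setoid : ℕ → Setoid _ _
  ≡-mod-setoid n = record { isEquivalence = ≡-mod-isEquivalence {n} }

  module ≡-mod-Reasoning (n : ℕ) = SetoidReasoning (≡-mod-setoid n)

  module _ {n : ℕ} where

    +-cong : ∀ {x y u v} → x ≡ y mod n → u ≡ v mod n → x + u ≡ y + v mod n
    +-cong {x} {y} {u} {v} (≡-mod n∣x-y) (≡-mod n∣u-v) =
      ≡-mod (subst (+ n ∣_) (lemma x y u v) (∣m∣n⇒∣m+n n∣x-y n∣u-v))
      where
      lemma : ∀ x y u v → (x - y) + (u - v) ≡ (x + u) - (y + v)
      lemma = solve-∀

    *-cong : ∀ {x y u v} → x ≡ y mod n → u ≡ v mod n → x * u ≡ y * v mod n
    *-cong {x} {y} {u} {v} (≡-mod n∣x-y) (≡-mod n∣u-v) =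
      ≡-mod (subst (+ n ∣_) (lemma x y u v) (∣m∣n⇒∣m+n (∣n⇒∣m*n x n∣u-v) (∣m⇒∣m*n v n∣x-y)))
      where
      lemma : ∀ x y u v → x * (u - v) + (x - y) * v ≡ x * u - y * v
      lemma = solve-∀

    *-congˡ : ∀ z {x y} → x ≡ y mod n → z * x ≡ z * y mod n
    *-congˡ z = *-cong (≡-mod-refl {x = z})

    *-congʳ : ∀ z {x y} → x ≡ y mod n → x * z ≡ y * z mod n
    *-congʳ z x≡y = *-cong x≡y (≡-mod-refl {x = z})

    ^-cong : ∀ {x y} k → x ≡ y mod n → x ^ k ≡ y ^ k mod n
    ^-cong zero    x≡y = ≡-mod-refl
    ^-cong (suc k) x≡y = *-cong x≡y (^-cong k x≡y)

    +-cancelˡ-≡-mod : ∀ z {x y} → z + x ≡ z + y mod n → x ≡ y mod n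
    +-cancelˡ-≡-mod z {x} {y} (≡-mod n∣d) = ≡-mod (subst (+ n ∣_) (lemma z x y) n∣d)
      where
      lemma : ∀ z x y → z + x - (z + y) ≡ x - y
      lemma = solve-∀

    *-cancelʳ-invertible : ∀ {x x⁻¹ u w} → x * x⁻¹ ≡ 1ℤ mod n → u * x ≡ w * x mod n → u ≡ w mod n
    *-cancelʳ-invertible {x} {x⁻¹} {u} {w} xx⁻¹≡1 ux≡wx = begin
      u                ≡⟨ ℤ.*-identityʳ u ⟨
      u * 1ℤ           ≈⟨ *-congˡ u xx⁻¹≡1 ⟨
      u * (x * x⁻¹)    ≡⟨ ℤ.*-assoc u x x⁻¹ ⟨
      u * x * x⁻¹      ≈⟨ *-congʳ x⁻¹ ux≡wx ⟩
      w * x * x⁻¹      ≡⟨ ℤ.*-assoc w x x⁻¹ ⟩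
      w * (x * x⁻¹)    ≈⟨ *-congˡ w xx⁻¹≡1 ⟩
      w * 1ℤ           ≡⟨ ℤ.*-identityʳ w ⟩
      w                ∎
      where open ≡-mod-Reasoning n

  ≡-mod-*-cancelʳ : ∀ {n p x y} .{{_ : NonZero p}} → x * + p ≡ y * + p mod p ℕ.* n → x ≡ y mod n
  ≡-mod-*-cancelʳ {n} {p} {x} {y} (≡-mod pn∣d) =
    ≡-mod (*-cancelʳ-∣ (+ p) (subst₂ _∣_ (trans (ℤ.pos-* p n) (ℤ.*-comm (+ p) (+ n))) (lemma x y (+ p)) pn∣d))
    where
    lemma : ∀ x y p → x * p - y * p ≡ (x - y) * p
    lemma = solve-∀

  ≡-mod-∣ : ∀ {m n x y} → m ℕ.∣ n → x ≡ y mod n → x ≡ y mod m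
  ≡-mod-∣ m∣n (≡-mod n∣x-y) = ≡-mod (∣-trans (∣ᵤ⇒∣ m∣n) n∣x-y)

  ≡-mod-*-coprime : ∀ {m n x y} → Coprime m n → x ≡ y mod m → x ≡ y mod n → x ≡ y mod m ℕ.* n
  ≡-mod-*-coprime {m} {n} coprime (≡-mod m∣x-y) (≡-mod n∣x-y) =
    ≡-mod (∣ᵤ⇒∣ (subst (ℕ._∣ _) lcm≡m*n (lcm-least (∣⇒∣ᵤ m∣x-y) (∣⇒∣ᵤ n∣x-y))))
    where
    lcm≡m*n : lcm m n ≡ m ℕ.* n
    lcm≡m*n = trans (sym (ℕ.*-identityˡ (lcm m n)))
                    (subst (λ g → g ℕ.* lcm m n ≡ m ℕ.* n) (coprime⇒gcd≡1 coprime) (gcd*lcm m n))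

  ≡-mod⇒∸≡0 : ∀ {a b n} → b ≤ a → a < n → + a ≡ + b mod n → a ℕ.∸ b ≡ 0
  ≡-mod⇒∸≡0 {a} {b} b≤a a<n (≡-mod n∣a-b) =
    n∣m<n⇒m≡0 (subst (λ d → _ ℕ.∣ ∣ d ∣) (trans (ℤ.m-n≡m⊖n a b) (ℤ.⊖-≥ b≤a)) (∣⇒∣ᵤ n∣a-b))
              (ℕ.≤-<-trans (ℕ.m∸n≤m a b) a<n)

  ≡-mod⇒≡ : ∀ {a b n} → a < n → b < n → + a ≡ + b mod n → a ≡ b
  ≡-mod⇒≡ {a} {b} a<n b<n a≡b with ℕ.≤-total b a
  ... | inj₁ b≤a = ℕ.≤-antisym (ℕ.m∸n≡0⇒m≤n (≡-mod⇒∸≡0 b≤a a<n a≡b)) b≤a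
  ... | inj₂ a≤b = ℕ.≤-antisym a≤b (ℕ.m∸n≡0⇒m≤n (≡-mod⇒∸≡0 a≤b b<n (≡-mod-sym a≡b)))

  n≡0-mod-n : ∀ {n} → + n ≡ 0ℤ mod n
  n≡0-mod-n {n} = ≡-mod (divides 1ℤ (trans (ℤ.+-identityʳ (+ n)) (sym (ℤ.*-identityˡ (+ n)))))

  ≡0-mod⇒∣ : ∀ {n x} → x ≡ 0ℤ mod n → + n ∣ x
  ≡0-mod⇒∣ {x = x} (≡-mod n∣x-0) = subst (_ ∣_) (ℤ.+-identityʳ x) n∣x-0

  pred≡-1 : ∀ n .{{_ : NonZero n}} → + (n ℕ.∸ 1) ≡ -1ℤ mod n
  pred≡-1 (suc n) = ≡-mod (divides 1ℤ (lemma (+ n)))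
    where
    lemma : ∀ x → x - -1ℤ ≡ 1ℤ * (1ℤ + x)
    lemma = solve-∀

  module _ {n : ℕ} .{{_ : NonZero n}} where

    %ℕ-≡-mod : ∀ x → x ≡ + (x %ℕ n) mod n
    %ℕ-≡-mod x = ≡-mod (divides (x /ℕ n) (begin
      x - + (x %ℕ n)                           ≡⟨ cong (_- + (x %ℕ n)) (a≡a%ℕn+[a/ℕn]*n x n) ⟩
      + (x %ℕ n) + x /ℕ n * + n - + (x %ℕ n)   ≡⟨ lemma (+ (x %ℕ n)) (x /ℕ n * + n) ⟩
      x /ℕ n * + n                             ∎))
      where
      open ≡-Reasoning
      lemma : ∀ r y → r + y - r ≡ y
      lemma = solve-∀

    %≡⇒≡-mod : ∀ {x r} → x % n ≡ r → + x ≡ + r mod n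
    %≡⇒≡-mod {x} refl = %ℕ-≡-mod (+ x)

    residue≢0 : ∀ x → ¬ x ≡ 0ℤ mod n → NonZero (x %ℕ n)
    residue≢0 x x≢0 = ℕ.≢-nonZero (λ r≡0 → x≢0 (subst (λ r → x ≡ + r mod n) r≡0 (%ℕ-≡-mod x)))

    nonzeroResidue : ∀ x → ¬ x ≡ 0ℤ mod n → Fin (n ℕ.∸ 1)
    nonzeroResidue x x≢0 = fromℕ< (ℕ.∸-monoˡ-< (n%ℕd<d x n) (ℕ.>-nonZero⁻¹ _ {{residue≢0 x x≢0}}))

    nonzeroResidue-≡-mod : ∀ x (x≢0 : ¬ x ≡ 0ℤ mod n) → x ≡ + suc (toℕ (nonzeroResidue x x≢0)) mod n
    nonzeroResidue-≡-mod x x≢0 = subst (λ r → x ≡ + r mod n) r≡1+[r-1] (%ℕ-≡-mod x)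
      where
      r≡1+[r-1] : x %ℕ n ≡ suc (toℕ (nonzeroResidue x x≢0))
      r≡1+[r-1] = sym (trans (cong suc (toℕ-fromℕ< _)) (ℕ.suc-pred _ {{residue≢0 x x≢0}}))

    nonzeroResidue-injective : ∀ {x y} (x≢0 : ¬ x ≡ 0ℤ mod n) (y≢0 : ¬ y ≡ 0ℤ mod n) →
                               nonzeroResidue x x≢0 ≡ nonzeroResidue y y≢0 → x ≡ y mod n
    nonzeroResidue-injective {x} {y} x≢0 y≢0 eq =
      ≡-mod-trans (nonzeroResidue-≡-mod x x≢0)
        (≡-mod-trans (≡-mod-reflexive (cong (λ i → + suc (toℕ i)) eq)) (≡-mod-sym (nonzeroResidue-≡-mod y y≢0)))

module Signs where

  open import Data.Integer.Base using (_*_; _^_; 0ℤ; 1ℤ; -1ℤ; _◃_)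
  open Congruence

  ◃1-* : ∀ s t → (s ◃ 1) * (t ◃ 1) ≡ (s Sign.* t) ◃ 1
  ◃1-* s t = sym (ℤ.◃-distrib-* s t 1 1)

  ◃1-square : ∀ s → (s ◃ 1) * (s ◃ 1) ≡ 1ℤ
  ◃1-square s = trans (◃1-* s s) (cong (_◃ 1) (Sign.s*s≡+ s))

  ◃1-^2 : ∀ s → (s ◃ 1) ^ 2 ≡ 1ℤ
  ◃1-^2 s = trans (cong ((s ◃ 1) *_) (ℤ.*-identityʳ (s ◃ 1))) (◃1-square s)

  ◃1-^-even : ∀ s n → ((s ◃ 1) ^ 2) ^ n ≡ 1ℤ
  ◃1-^-even s n = trans (cong (_^ n) (◃1-^2 s)) (ℤ.^-zeroˡ n)

  ◃1-^-odd : ∀ s {n} → ¬ 2 ℕ.∣ n → (s ◃ 1) ^ n ≡ s ◃ 1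
  ◃1-^-odd s {zero}        ¬2∣0   = ⊥-elim (¬2∣0 (2 ℕ.∣0))
  ◃1-^-odd s {suc zero}    _      = ℤ.*-identityʳ (s ◃ 1)
  ◃1-^-odd s {suc (suc n)} ¬2∣2+n = begin
    (s ◃ 1) * ((s ◃ 1) * (s ◃ 1) ^ n) ≡⟨ ℤ.*-assoc (s ◃ 1) (s ◃ 1) _ ⟨
    (s ◃ 1) * (s ◃ 1) * (s ◃ 1) ^ n   ≡⟨ cong (_* (s ◃ 1) ^ n) (◃1-square s) ⟩
    1ℤ * (s ◃ 1) ^ n                  ≡⟨ ℤ.*-identityˡ _ ⟩
    (s ◃ 1) ^ n                       ≡⟨ ◃1-^-odd s (λ 2∣n → ¬2∣2+n (ℕ.∣m∣n⇒∣m+n ℕ.∣-refl 2∣n)) ⟩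
    s ◃ 1                             ∎
    where open ≡-Reasoning

  ◃1-injective-mod : ∀ {s t q} → 3 ≤ q → s ◃ 1 ≡ t ◃ 1 mod q → s ≡ t
  ◃1-injective-mod {Sign.+} {Sign.+} _ _ = refl
  ◃1-injective-mod {Sign.-} {Sign.-} _ _ = refl
  ◃1-injective-mod {Sign.+} {Sign.-} 3≤q 1≡-1
    with () ← ≡-mod⇒≡ {2} {0} 3≤q (ℕ.<-trans ℕ.z<s 3≤q) (+-cong 1≡-1 (≡-mod-refl {x = 1ℤ}))
  ◃1-injective-mod {Sign.-} {Sign.+} 3≤q -1≡1
    with () ← ≡-mod⇒≡ {2} {0} 3≤q (ℕ.<-trans ℕ.z<s 3≤q) (+-cong (≡-mod-sym -1≡1) (≡-mod-refl {x = 1ℤ}))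

  ◃1≢0-mod : ∀ {s q} → 2 ≤ q → ¬ (s ◃ 1 ≡ 0ℤ mod q)
  ◃1≢0-mod {Sign.+} 2≤q 1≡0 with () ← ≡-mod⇒≡ {1} {0} 2≤q (ℕ.<-trans ℕ.z<s 2≤q) 1≡0
  ◃1≢0-mod {Sign.-} 2≤q -1≡0 with () ← ≡-mod⇒≡ {1} {0} 2≤q (ℕ.<-trans ℕ.z<s 2≤q) (*-congˡ -1ℤ -1≡0)

module Powers where

  open import Data.Nat.Coprimality using (Coprime; coprime-Bézout)
  open import Data.Nat.GCD using (module Bézout)
  open import Data.Integer.Base using (ℤ; +_; _+_; _-_; _*_; _^_; 0ℤ; 1ℤ; ∣_∣)
  open import Data.Integer.Divisibility.Signed using (_∣_; divides; ∣ᵤ⇒∣; ∣⇒∣ᵤ)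
  open import Data.Integer.Tactic.RingSolver using (solve-∀)
  open Congruence

  ^-distribʳ-* : ∀ x y n → (x * y) ^ n ≡ x ^ n * y ^ n
  ^-distribʳ-* x y zero    = refl
  ^-distribʳ-* x y (suc n) = trans (cong (x * y *_) (^-distribʳ-* x y n)) (lemma x y (x ^ n) (y ^ n))
    where
    lemma : ∀ x y u v → x * y * (u * v) ≡ x * u * (y * v)
    lemma = solve-∀

  pos-^ : ∀ a n → + (a ℕ.^ n) ≡ (+ a) ^ n
  pos-^ a zero    = refl
  pos-^ a (suc n) = trans (ℤ.pos-* a (a ℕ.^ n)) (cong (+ a *_) (pos-^ a n))

  ^-+-order : ∀ {P n} v r y → v ^ P ≡ 1ℤ mod n → v ^ (r ℕ.+ y ℕ.* P) ≡ v ^ r mod n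
  ^-+-order {P} {n} v r y v^P≡1 = begin
    v ^ (r ℕ.+ y ℕ.* P)    ≡⟨ ℤ.^-distribˡ-+-* v r (y ℕ.* P) ⟩
    v ^ r * v ^ (y ℕ.* P)  ≡⟨ cong (λ e → v ^ r * v ^ e) (ℕ.*-comm y P) ⟩
    v ^ r * v ^ (P ℕ.* y)  ≡⟨ cong (v ^ r *_) (ℤ.^-*-assoc v P y) ⟨
    v ^ r * (v ^ P) ^ y    ≈⟨ *-congˡ (v ^ r) (^-cong y v^P≡1) ⟩
    v ^ r * 1ℤ ^ y         ≡⟨ cong (v ^ r *_) (ℤ.^-zeroˡ y) ⟩
    v ^ r * 1ℤ             ≡⟨ ℤ.*-identityʳ (v ^ r) ⟩
    v ^ r                  ∎
    where open ≡-mod-Reasoning n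

  ^≡1⇒invertible : ∀ {q} x n .{{_ : NonZero n}} → x ^ n ≡ 1ℤ mod q → x * x ^ (n ℕ.∸ 1) ≡ 1ℤ mod q
  ^≡1⇒invertible x n x^n≡1 = subst (λ e → x ^ e ≡ 1ℤ mod _) (sym (ℕ.suc-pred n)) x^n≡1

  geometric : ℤ → ℕ → ℤ
  geometric x zero    = 0ℤ
  geometric x (suc n) = x ^ n + geometric x n

  ^-1≡[x-1]*geometric : ∀ x n → x ^ n - 1ℤ ≡ (x - 1ℤ) * geometric x n
  ^-1≡[x-1]*geometric x zero    = lemma x
    where
    lemma : ∀ x → 1ℤ - 1ℤ ≡ (x - 1ℤ) * 0ℤ
    lemma = solve-∀
  ^-1≡[x-1]*geometric x (suc n) = begin
    x * x ^ n - 1ℤ                               ≡⟨ lemma x (x ^ n) ⟩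
    (x - 1ℤ) * x ^ n + (x ^ n - 1ℤ)              ≡⟨ cong (λ y → (x - 1ℤ) * x ^ n + y) (^-1≡[x-1]*geometric x n) ⟩
    (x - 1ℤ) * x ^ n + (x - 1ℤ) * geometric x n  ≡⟨ ℤ.*-distribˡ-+ (x - 1ℤ) (x ^ n) _ ⟨
    (x - 1ℤ) * (x ^ n + geometric x n)           ∎
    where
    open ≡-Reasoning
    lemma : ∀ x y → x * y - 1ℤ ≡ (x - 1ℤ) * y + (y - 1ℤ)
    lemma = solve-∀

  geometric-≡-mod : ∀ {x M} n → x ≡ 1ℤ mod M → geometric x n ≡ + n mod M
  geometric-≡-mod         zero    _   = ≡-mod-refl
  geometric-≡-mod {x} {M} (suc n) x≡1 = begin
    x ^ n + geometric x n  ≈⟨ +-cong (^-cong n x≡1) (geometric-≡-mod n x≡1) ⟩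
    1ℤ ^ n + + n           ≡⟨ cong (_+ + n) (ℤ.^-zeroˡ n) ⟩
    1ℤ + + n               ≡⟨ ℤ.pos-+ 1 n ⟨
    + suc n                ∎
    where open ≡-mod-Reasoning M

  ≡1-^-lift : ∀ {p M x} → p ℕ.∣ M → x ≡ 1ℤ mod M → x ^ p ≡ 1ℤ mod p ℕ.* M
  ≡1-^-lift {p} {M} {x} p∣M x≡1@(≡-mod M∣x-1) =
    ≡-mod (∣ᵤ⇒∣ (subst (p ℕ.* M ℕ.∣_) ∣G*[x-1]∣≡∣x^p-1∣
                       (ℕ.*-pres-∣ (∣⇒∣ᵤ p∣G) (∣⇒∣ᵤ M∣x-1))))
    where
    G : ℤ
    G = geometric x p
    p∣G : + p ∣ G
    p∣G = ≡0-mod⇒∣ (≡-mod-trans (geometric-≡-mod p (≡-mod-∣ p∣M x≡1)) n≡0-mod-n)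
    ∣G*[x-1]∣≡∣x^p-1∣ : ∣ G ∣ ℕ.* ∣ x - 1ℤ ∣ ≡ ∣ x ^ p - 1ℤ ∣
    ∣G*[x-1]∣≡∣x^p-1∣ =
      trans (sym (ℤ.abs-* G (x - 1ℤ))) (cong ∣_∣ (trans (ℤ.*-comm G (x - 1ℤ)) (sym (^-1≡[x-1]*geometric x p))))

  principal : ℕ → ℕ → ℤ
  principal p k = 1ℤ + + k * + p

  principal-^-order : ∀ p k j → principal p k ^ (p ℕ.^ j) ≡ 1ℤ mod p ℕ.^ suc j
  principal-^-order p k zero    =
    ≡-mod (divides (+ k) (trans (lemma (+ k) (+ p)) (cong (+ k *_) (sym (ℤ.pos-* p 1)))))
    where
    lemma : ∀ k p → (1ℤ + k * p) * 1ℤ - 1ℤ ≡ k * (p * 1ℤ)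
    lemma = solve-∀
  principal-^-order p k (suc j) =
    subst (λ e → principal p k ^ e ≡ 1ℤ mod p ℕ.^ suc (suc j)) (ℕ.*-comm (p ℕ.^ j) p)
      (subst (_≡ 1ℤ mod p ℕ.^ suc (suc j)) (ℤ.^-*-assoc (principal p k) (p ℕ.^ j) p)
        (≡1-^-lift {p} (ℕ.m∣m*n (p ℕ.^ j)) (principal-^-order p k j)))

  principal-injective : ∀ {p P k k'} .{{_ : NonZero p}} → k < P → k' < P →
                        principal p k ≡ principal p k' mod p ℕ.* P → k ≡ k'
  principal-injective k<P k'<P u≡u' = ≡-mod⇒≡ k<P k'<P (≡-mod-*-cancelʳ (+-cancelˡ-≡-mod 1ℤ u≡u'))

  rootOfUnity-^-injective : ∀ {g P n u w} → Coprime g P → u ^ P ≡ 1ℤ mod n → w ^ P ≡ 1ℤ mod n →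
                            u ^ g ≡ w ^ g mod n → u ≡ w mod n
  rootOfUnity-^-injective {g} {P} {n} {u} {w} coprime u^P≡1 w^P≡1 u^g≡w^g with coprime-Bézout coprime
  ... | Bézout.+- x y 1+yP≡xg = begin
    u                   ≡⟨ ℤ.^-identityʳ u ⟨
    u ^ 1               ≈⟨ ^-+-order u 1 y u^P≡1 ⟨
    u ^ (1 ℕ.+ y ℕ.* P) ≡⟨ power-of-power u ⟩
    (u ^ g) ^ x         ≈⟨ ^-cong x u^g≡w^g ⟩
    (w ^ g) ^ x         ≡⟨ power-of-power w ⟨
    w ^ (1 ℕ.+ y ℕ.* P) ≈⟨ ^-+-order w 1 y w^P≡1 ⟩
    w ^ 1               ≡⟨ ℤ.^-identityʳ w ⟩
    w                   ∎
    where
    open ≡-mod-Reasoning n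
    power-of-power : ∀ v → v ^ (1 ℕ.+ y ℕ.* P) ≡ (v ^ g) ^ x
    power-of-power v = trans (cong (v ^_) (trans 1+yP≡xg (ℕ.*-comm x g))) (sym (ℤ.^-*-assoc v g x))
  ... | Bézout.-+ x y 1+xg≡yP =
    *-cancelʳ-invertible (≡-mod-trans (≡-mod-reflexive (ℤ.*-comm ((u ^ g) ^ x) u)) (inverse u^P≡1)) (begin
      u * (u ^ g) ^ x  ≈⟨ inverse u^P≡1 ⟩
      1ℤ               ≈⟨ inverse w^P≡1 ⟨
      w * (w ^ g) ^ x  ≈⟨ *-congˡ w (^-cong x u^g≡w^g) ⟨
      w * (u ^ g) ^ x  ∎)
    where
    open ≡-mod-Reasoning n
    inverse : ∀ {v} → v ^ P ≡ 1ℤ mod n → v * (v ^ g) ^ x ≡ 1ℤ mod n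
    inverse {v} v^P≡1 = begin
      v * (v ^ g) ^ x       ≡⟨ cong (v *_) (ℤ.^-*-assoc v g x) ⟩
      v ^ suc (g ℕ.* x)     ≡⟨ cong (λ e → v ^ suc e) (ℕ.*-comm g x) ⟩
      v ^ (1 ℕ.+ x ℕ.* g)   ≡⟨ cong (v ^_) 1+xg≡yP ⟩
      v ^ (0 ℕ.+ y ℕ.* P)   ≈⟨ ^-+-order v 0 y v^P≡1 ⟩
      1ℤ                    ∎

module Coprimality where

  open import Data.Nat.Coprimality using (Coprime; coprime-divisor)
  import Data.Nat.Coprimality as Coprime
  open import Data.Nat.Primality using (Prime; prime⇒irreducible; ¬prime[1])

  coprime-*ʳ : ∀ {m n o} → Coprime m n → Coprime m o → Coprime m (n ℕ.* o)
  coprime-*ʳ {n = n} m⊥n m⊥o {i} (i∣m , i∣no) = m⊥o (i∣m , coprime-divisor i⊥n i∣no)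
    where
    i⊥n : Coprime i n
    i⊥n (j∣i , j∣n) = m⊥n (ℕ.∣-trans j∣i i∣m , j∣n)

  coprime-product : ∀ {m ns} → All (Coprime m) ns → Coprime m (product ns)
  coprime-product []            (_ , i∣1) = ℕ.∣1⇒≡1 i∣1
  coprime-product (m⊥n ∷ m⊥ns) = coprime-*ʳ m⊥n (coprime-product m⊥ns)

  coprime-^ʳ : ∀ {m n} k → Coprime m n → Coprime m (n ℕ.^ k)
  coprime-^ʳ zero    _   (_ , i∣1) = ℕ.∣1⇒≡1 i∣1
  coprime-^ʳ (suc k) m⊥n = coprime-*ʳ m⊥n (coprime-^ʳ k m⊥n)

  coprime-^ : ∀ {m n} a b → Coprime m n → Coprime (m ℕ.^ a) (n ℕ.^ b)
  coprime-^ a b m⊥n = coprime-^ʳ b (Coprime.sym (coprime-^ʳ a (Coprime.sym m⊥n)))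

  prime∤⇒coprime : ∀ {p n} → Prime p → ¬ p ℕ.∣ n → Coprime p n
  prime∤⇒coprime p-prime p∤n (i∣p , i∣n) with prime⇒irreducible p-prime i∣p
  ... | inj₁ i≡1  = i≡1
  ... | inj₂ refl = ⊥-elim (p∤n i∣n)

  distinct-primes-coprime : ∀ {p q} → Prime p → Prime q → p ≢ q → Coprime p q
  distinct-primes-coprime {p} {q} p-prime q-prime p≢q = prime∤⇒coprime p-prime p∤q
    where
    p∤q : ¬ p ℕ.∣ q
    p∤q p∣q with prime⇒irreducible q-prime p∣q
    ... | inj₁ refl = ¬prime[1] p-prime
    ... | inj₂ p≡q  = p≢q p≡q

  primePower : ℕ × ℕ → ℕ
  primePower pe = proj₁ pe ℕ.^ proj₂ pe

  distinct-prime-powers-coprime : ∀ {ps} → All (λ pe → Prime (proj₁ pe)) ps → AllPairs _≢_ (map proj₁ ps) →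
                                  AllPairs Coprime (map primePower ps)
  distinct-prime-powers-coprime {[]}          []                 []                = []
  distinct-prime-powers-coprime {(p , e) ∷ _} (p-prime ∷ primes) (p∉ps ∷ distinct) =
    All.map⁺ (coprime-to-rest primes (All.map⁻ p∉ps)) ∷ distinct-prime-powers-coprime primes distinct
    where
    coprime-to-rest : ∀ {ps} → All (λ pe → Prime (proj₁ pe)) ps → All (λ pe → p ≢ proj₁ pe) ps →
                      All (λ pe → Coprime (p ℕ.^ e) (primePower pe)) ps
    coprime-to-rest {[]}          []                 []           = []
    coprime-to-rest {(_ , f) ∷ _} (q-prime ∷ primes) (p≢q ∷ p∉ps) =
      coprime-^ e f (distinct-primes-coprime p-prime q-prime p≢q) ∷ coprime-to-rest primes p∉ps

module ChineseRemainder where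

  open import Data.Nat.Coprimality using (Coprime; coprime-Bézout)
  open import Data.Nat.GCD using (module Bézout)
  open import Data.Nat.ListAction.Properties using (∈⇒∣product)
  open import Data.Integer.Base using (ℤ; +_; _+_; _-_; _*_; -_; 0ℤ; 1ℤ)
  open import Data.Integer.Divisibility.Signed using (divides)
  open import Data.Integer.Tactic.RingSolver using (solve-∀)
  open Congruence
  open Coprimality using (coprime-product)

  coprime⇒idempotent : ∀ {m n} → Coprime m n → ∃ λ e → e ≡ 0ℤ mod m × e ≡ 1ℤ mod n
  coprime⇒idempotent {m} {n} coprime with coprime-Bézout coprime
  ... | Bézout.+- x y 1+yn≡xm = + (x ℕ.* m) , ≡-mod (divides (+ x) e-0≡xm) , ≡-mod (divides (+ y) e-1≡yn)
    where
    e-0≡xm : + (x ℕ.* m) - 0ℤ ≡ + x * + m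
    e-0≡xm = trans (ℤ.+-identityʳ _) (ℤ.pos-* x m)
    e-1≡yn : + (x ℕ.* m) - 1ℤ ≡ + y * + n
    e-1≡yn = begin
      + (x ℕ.* m) - 1ℤ        ≡⟨ cong (λ k → + k - 1ℤ) 1+yn≡xm ⟨
      + (1 ℕ.+ y ℕ.* n) - 1ℤ  ≡⟨ cong (_- 1ℤ) (trans (ℤ.pos-+ 1 (y ℕ.* n)) (cong (_+_ 1ℤ) (ℤ.pos-* y n))) ⟩
      1ℤ + + y * + n - 1ℤ     ≡⟨ lemma (+ y * + n) ⟩
      + y * + n               ∎
      where
      open ≡-Reasoning
      lemma : ∀ k → 1ℤ + k - 1ℤ ≡ k
      lemma = solve-∀
  ... | Bézout.-+ x y 1+xm≡yn = - + (x ℕ.* m) , ≡-mod (divides (- + x) e-0≡-xm) , ≡-mod (divides (- + y) e-1≡-yn)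
    where
    e-0≡-xm : - + (x ℕ.* m) - 0ℤ ≡ - + x * + m
    e-0≡-xm = trans (ℤ.+-identityʳ _) (trans (cong -_ (ℤ.pos-* x m)) (ℤ.neg-distribˡ-* (+ x) (+ m)))
    e-1≡-yn : - + (x ℕ.* m) - 1ℤ ≡ - + y * + n
    e-1≡-yn = begin
      - + (x ℕ.* m) - 1ℤ      ≡⟨ lemma (+ (x ℕ.* m)) ⟩
      - (1ℤ + + (x ℕ.* m))    ≡⟨ cong -_ (ℤ.pos-+ 1 (x ℕ.* m)) ⟨
      - + (1 ℕ.+ x ℕ.* m)     ≡⟨ cong (λ k → - + k) 1+xm≡yn ⟩
      - + (y ℕ.* n)           ≡⟨ cong -_ (ℤ.pos-* y n) ⟩
      - (+ y * + n)           ≡⟨ ℤ.neg-distribˡ-* (+ y) (+ n) ⟩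
      - + y * + n             ∎
      where
      open ≡-Reasoning
      lemma : ∀ k → - k - 1ℤ ≡ - (1ℤ + k)
      lemma = solve-∀

  crt₂ : ∀ {m n} → Coprime m n → ∀ a b → ∃ λ y → y ≡ a mod m × y ≡ b mod n
  crt₂ coprime a b with e , e≡0 , e≡1 ← coprime⇒idempotent coprime =
    a + (b - a) * e ,
    ≡-mod-trans (+-cong (≡-mod-refl {x = a}) (*-congˡ (b - a) e≡0)) (≡-mod-reflexive (lemma₀ a b)) ,
    ≡-mod-trans (+-cong (≡-mod-refl {x = a}) (*-congˡ (b - a) e≡1)) (≡-mod-reflexive (lemma₁ a b))
    where
    lemma₀ : ∀ a b → a + (b - a) * 0ℤ ≡ a
    lemma₀ = solve-∀
    lemma₁ : ∀ a b → a + (b - a) * 1ℤ ≡ b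
    lemma₁ = solve-∀

  infix 4 _solves_
  _solves_ : ℤ → List (ℕ × ℤ) → Set
  y solves congruences = All (λ c → y ≡ proj₂ c mod proj₁ c) congruences

  solves-≡-mod : ∀ {M y z} cs → All (λ c → proj₁ c ℕ.∣ M) cs → z ≡ y mod M → y solves cs → z solves cs
  solves-≡-mod []       []            _   []              = []
  solves-≡-mod (_ ∷ cs) (c∣M ∷ cs∣M) z≡y (y≡a ∷ y-solves) =
    ≡-mod-trans (≡-mod-∣ c∣M z≡y) y≡a ∷ solves-≡-mod cs cs∣M z≡y y-solves

  crt : ∀ congruences → AllPairs (Coprime on proj₁) congruences → ∃ (_solves congruences)
  crt []                      []                  = 0ℤ , []
  crt ((m , a) ∷ congruences) (m⊥rest ∷ pairwise) = z , z≡a ∷ solves-≡-mod congruences moduli∣M z≡y y-solves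
    where
    M : ℕ
    M = product (map proj₁ congruences)
    m⊥M : Coprime m M
    m⊥M = coprime-product (All.map⁺ {P = Coprime m} {f = proj₁} m⊥rest)
    moduli∣M : All (λ c → proj₁ c ℕ.∣ M) congruences
    moduli∣M = All.map⁻ {P = ℕ._∣ M} {f = proj₁} (All.tabulate ∈⇒∣product)
    y : ℤ
    y = proj₁ (crt congruences pairwise)
    y-solves : y solves congruences
    y-solves = proj₂ (crt congruences pairwise)
    z : ℤ
    z = proj₁ (crt₂ m⊥M a y)
    z≡a : z ≡ a mod m
    z≡a = proj₁ (proj₂ (crt₂ m⊥M a y))
    z≡y : z ≡ y mod M
    z≡y = proj₂ (proj₂ (crt₂ m⊥M a y))

  ≡-mod-product : ∀ {ms x y} → AllPairs Coprime ms → All (λ m → x ≡ y mod m) ms → x ≡ y mod product ms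
  ≡-mod-product {x = x} {y} []                []                 =
    ≡-mod (divides (x - y) (sym (ℤ.*-identityʳ (x - y))))
  ≡-mod-product             (m⊥ms ∷ pairwise) (x≡y ∷ x≡y-rest) =
    ≡-mod-*-coprime (coprime-product m⊥ms) x≡y (≡-mod-product pairwise x≡y-rest)

module Injections where

  open import Function.Bundles using (_↣_; mk↣)
  open import Function.Definitions using (Injective)

  lookup-injective : ∀ {A : Set} {xs : List A} → AllPairs _≢_ xs → ∀ {i j} → lookup xs i ≡ lookup xs j → i ≡ j
  lookup-injective (_ ∷ _)        {zero}  {zero}  _     = refl
  lookup-injective (x∉xs ∷ _)     {zero}  {suc j} x≡xⱼ  = ⊥-elim (All.lookup x∉xs (∈-lookup j) x≡xⱼ)
  lookup-injective (x∉xs ∷ _)     {suc i} {zero}  xᵢ≡x  = ⊥-elim (All.lookup x∉xs (∈-lookup i) (sym xᵢ≡x))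
  lookup-injective (_ ∷ distinct) {suc i} {suc j} xᵢ≡xⱼ = cong suc (lookup-injective distinct xᵢ≡xⱼ)

  Fin1↣All[] : ∀ {A : Set} {P : A → Set} → Fin 1 ↣ All P []
  Fin1↣All[] = mk↣ {to = λ _ → []} λ { {zero} {zero} _ → refl }

  ×↣All∷ : ∀ {A : Set} {P : A → Set} {x xs} → (P x × All P xs) ↣ All P (x ∷ xs)
  ×↣All∷ = mk↣ {to = uncurry _∷_} λ eq → cong₂ _,_ (cong All.head eq) (cong All.tail eq)

  Fin2↣Sign : Fin 2 ↣ Sign
  Fin2↣Sign = mk↣ {to = toSign} toSign-injective
    where
    toSign : Fin 2 → Sign
    toSign zero       = Sign.+
    toSign (suc zero) = Sign.-
    toSign-injective : Injective _≡_ _≡_ toSign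
    toSign-injective {zero}     {zero}     _  = refl
    toSign-injective {suc zero} {suc zero} _  = refl
    toSign-injective {zero}     {suc zero} ()
    toSign-injective {suc zero} {zero}     ()

module Counting where

  open import Data.Nat.Coprimality using (Coprime)
  import Data.Nat.Coprimality as Coprime
  open import Data.Nat.Primality using (Prime; prime⇒nonZero; prime⇒nonTrivial; ¬prime[1])
  open import Data.Integer.Base using (ℤ; +_; _+_; _*_; _^_; 0ℤ; 1ℤ; -1ℤ; _◃_)
  open import Data.Integer.Tactic.RingSolver using (solve-∀)
  open import Data.Nat.Tactic.RingSolver renaming (solve-∀ to ℕ-solve-∀)
  open import Data.Fin.Properties using (toℕ<n; toℕ-injective; *↔×; injective⇒≤)
  open import Function.Bundles using (_↣_; mk↣; Injection)
  open import Function.Definitions using (Injective)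
  open import Function.Properties.Inverse using (↔⇒↣)
  open import Function.Construct.Composition using (_↣-∘_)
  open import Function.Construct.Identity using (↣-id)
  open import Data.Product.Function.NonDependent.Propositional using (_×-↣_)
  open import Defs using (reducedProduct)
  open Arithmetic using (product-map-2*)
  open Congruence
  open Signs
  open Powers
  open Coprimality
  open ChineseRemainder
  open Injections

  module LiarCount (N m : ℕ) .{{_ : NonZero N}} .{{_ : NonZero m}} (N-odd : ¬ 2 ℕ.∣ N)
                   (m*2∣N-1 : m ℕ.* 2 ℕ.∣ N ℕ.∸ 1) (B : ℤ) (B^m≡-1 : B ^ m ≡ -1ℤ mod N) where

    ^m≡±1⇒^[m*N]≡±1 : ∀ {x n s} → x ^ m ≡ s ◃ 1 mod n → x ^ (m ℕ.* N) ≡ s ◃ 1 mod n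
    ^m≡±1⇒^[m*N]≡±1 {x} {n} {s} x^m≡s = begin
      x ^ (m ℕ.* N)  ≡⟨ ℤ.^-*-assoc x m N ⟨
      (x ^ m) ^ N    ≈⟨ ^-cong N x^m≡s ⟩
      (s ◃ 1) ^ N    ≡⟨ ◃1-^-odd s N-odd ⟩
      s ◃ 1          ∎
      where open ≡-mod-Reasoning n

    ^m≡±1⇒^[N-1]≡1 : ∀ {x n s} → x ^ m ≡ s ◃ 1 mod n → x ^ (N ℕ.∸ 1) ≡ 1ℤ mod n
    ^m≡±1⇒^[N-1]≡1 {x} {n} {s} x^m≡s = begin
      x ^ (N ℕ.∸ 1)          ≡⟨ cong (x ^_) (ℕ.m∣n⇒n≡m*quotient m*2∣N-1) ⟩
      x ^ (m ℕ.* 2 ℕ.* c)    ≡⟨ cong (x ^_) (ℕ.*-assoc m 2 c) ⟩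
      x ^ (m ℕ.* (2 ℕ.* c))  ≡⟨ ℤ.^-*-assoc x m (2 ℕ.* c) ⟨
      (x ^ m) ^ (2 ℕ.* c)    ≡⟨ ℤ.^-*-assoc (x ^ m) 2 c ⟨
      ((x ^ m) ^ 2) ^ c      ≈⟨ ^-cong c (^-cong 2 x^m≡s) ⟩
      ((s ◃ 1) ^ 2) ^ c      ≡⟨ ◃1-^-even s c ⟩
      1ℤ                     ∎
      where
      open ≡-mod-Reasoning n
      c : ℕ
      c = ℕ.quotient m*2∣N-1

    base : Sign → ℤ
    base Sign.+ = 1ℤ
    base Sign.- = B

    base-^m : ∀ σ {q} → q ℕ.∣ N → base σ ^ m ≡ σ ◃ 1 mod q
    base-^m Sign.+ _   = ≡-mod-reflexive (ℤ.^-zeroˡ m)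
    base-^m Sign.- q∣N = ≡-mod-∣ q∣N B^m≡-1

    target : ℕ → Sign → ℕ → ℤ
    target p σ k = base σ * principal p k

    Choice : ℕ × ℕ → Set
    Choice (p , e) = Sign × Fin (p ℕ.^ (e ℕ.∸ 1))

    module AtPrimePower (p j : ℕ) (p-prime : Prime p) (q∣N : p ℕ.^ suc j ℕ.∣ N) where

      q P : ℕ
      q = p ℕ.^ suc j
      P = p ℕ.^ j

      instance
        P≢0 : NonZero P
        P≢0 = ℕ.m^n≢0 p j {{prime⇒nonZero p-prime}}

      principal^P≡1 : ∀ k → principal p k ^ P ≡ 1ℤ mod q
      principal^P≡1 k = principal-^-order p k j

      principal^N≡1 : ∀ k → principal p k ^ N ≡ 1ℤ mod q
      principal^N≡1 k = subst (λ e → principal p k ^ e ≡ 1ℤ mod q) (sym N≡c*P)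
                              (^-+-order (principal p k) 0 (ℕ.quotient P∣N) (principal^P≡1 k))
        where
        P∣N : P ℕ.∣ N
        P∣N = ℕ.∣-trans (ℕ.n∣m*n p) q∣N
        N≡c*P : N ≡ ℕ.quotient P∣N ℕ.* P
        N≡c*P = ℕ.m∣n⇒n≡quotient*m P∣N

      p∣N : p ℕ.∣ N
      p∣N = ℕ.∣-trans (ℕ.m∣m*n P) q∣N

      3≤p : 3 ≤ p
      3≤p = ℕ.≤∧≢⇒< (ℕ.nonTrivial⇒n>1 p {{prime⇒nonTrivial p-prime}}) 2≢p
        where
        2≢p : 2 ≢ p
        2≢p refl = N-odd p∣N

      3≤q : 3 ≤ q
      3≤q = ℕ.≤-trans 3≤p (ℕ.m≤m*n p P)

      N-1⊥P : Coprime (N ℕ.∸ 1) P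
      N-1⊥P = coprime-^ʳ j (Coprime.sym (prime∤⇒coprime p-prime p∤N-1))
        where
        p∤N-1 : ¬ p ℕ.∣ N ℕ.∸ 1
        p∤N-1 p∣N-1 = ¬prime[1] (subst Prime (ℕ.∣1⇒≡1 (ℕ.∣m+n∣m⇒∣n p∣N-1+1 p∣N-1)) p-prime)
          where
          p∣N-1+1 : p ℕ.∣ N ℕ.∸ 1 ℕ.+ 1
          p∣N-1+1 = subst (p ℕ.∣_) (sym (ℕ.m∸n+n≡m (ℕ.>-nonZero⁻¹ N))) p∣N

      sign-of-^[m*N] : ∀ {a Y σ k ε} → (+ a) ^ m ≡ ε ◃ 1 mod N → Y ≡ target p σ k mod q →
                       (+ a * Y) ^ (m ℕ.* N) ≡ (ε Sign.* σ) ◃ 1 mod q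
      sign-of-^[m*N] {a} {Y} {σ} {k} {ε} a^m≡ε Y≡target = begin
        (+ a * Y) ^ (m ℕ.* N)                                    ≈⟨ ^-cong (m ℕ.* N) (*-congˡ (+ a) Y≡target) ⟩
        (+ a * (base σ * u)) ^ (m ℕ.* N)                         ≡⟨ ^-distribʳ-* (+ a) (base σ * u) (m ℕ.* N) ⟩
        (+ a) ^ (m ℕ.* N) * (base σ * u) ^ (m ℕ.* N)             ≡⟨ cong ((+ a) ^ (m ℕ.* N) *_) (^-distribʳ-* (base σ) u (m ℕ.* N)) ⟩
        (+ a) ^ (m ℕ.* N) * (base σ ^ (m ℕ.* N) * u ^ (m ℕ.* N)) ≈⟨ *-cong a^mN≡ε (*-cong base^mN≡σ u^mN≡1) ⟩
        (ε ◃ 1) * ((σ ◃ 1) * 1ℤ)                                 ≡⟨ cong ((ε ◃ 1) *_) (ℤ.*-identityʳ (σ ◃ 1)) ⟩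
        (ε ◃ 1) * (σ ◃ 1)                                        ≡⟨ ◃1-* ε σ ⟩
        (ε Sign.* σ) ◃ 1                                         ∎
        where
        open ≡-mod-Reasoning q
        u : ℤ
        u = principal p k
        a^mN≡ε : (+ a) ^ (m ℕ.* N) ≡ ε ◃ 1 mod q
        a^mN≡ε = ≡-mod-∣ q∣N (^m≡±1⇒^[m*N]≡±1 a^m≡ε)
        base^mN≡σ : base σ ^ (m ℕ.* N) ≡ σ ◃ 1 mod q
        base^mN≡σ = ^m≡±1⇒^[m*N]≡±1 (base-^m σ q∣N)
        u^mN≡1 : u ^ (m ℕ.* N) ≡ 1ℤ mod q
        u^mN≡1 = ^-+-order u 0 m (principal^N≡1 k)

      signs-agree : ∀ {a a' Y Y' σ σ' k k' ε ε'} → (+ a) ^ m ≡ ε ◃ 1 mod N → (+ a') ^ m ≡ ε' ◃ 1 mod N →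
                    Y ≡ target p σ k mod q → Y' ≡ target p σ' k' mod q → + a * Y ≡ + a' * Y' mod q →
                    ε Sign.* σ ≡ ε' Sign.* σ'
      signs-agree {a} {a'} {Y} {Y'} {σ} {σ'} {k} {k'} {ε} {ε'} a^m≡ε a'^m≡ε' Y≡target Y'≡target aY≡a'Y' =
        ◃1-injective-mod 3≤q (begin
          (ε Sign.* σ) ◃ 1           ≈⟨ sign-of-^[m*N] {σ = σ} {k = k} a^m≡ε Y≡target ⟨
          (+ a * Y) ^ (m ℕ.* N)      ≈⟨ ^-cong (m ℕ.* N) aY≡a'Y' ⟩
          (+ a' * Y') ^ (m ℕ.* N)    ≈⟨ sign-of-^[m*N] {σ = σ'} {k = k'} a'^m≡ε' Y'≡target ⟩
          (ε' Sign.* σ') ◃ 1         ∎)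
        where open ≡-mod-Reasoning q

      target-multiple≢0 : ∀ {a Y σ k ε} → (+ a) ^ m ≡ ε ◃ 1 mod N → Y ≡ target p σ k mod q →
                          ¬ (+ a * Y ≡ 0ℤ mod q)
      target-multiple≢0 {a} {Y} {σ} {k} a^m≡ε Y≡target aY≡0 =
        ◃1≢0-mod (ℕ.<⇒≤ 3≤q) (≡-mod-trans (≡-mod-sym (sign-of-^[m*N] {σ = σ} {k = k} a^m≡ε Y≡target))
                                          (≡-mod-trans (^-cong (m ℕ.* N) aY≡0) (≡-mod-reflexive 0^mN≡0)))
        where
        0^mN≡0 : 0ℤ ^ (m ℕ.* N) ≡ 0ℤ
        0^mN≡0 = subst (λ e → 0ℤ ^ e ≡ 0ℤ) (ℕ.suc-pred (m ℕ.* N) {{ℕ.m*n≢0 m N}}) refl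

      base-invertible : ∀ σ → base σ * base σ ^ (m ℕ.* 2 ℕ.∸ 1) ≡ 1ℤ mod q
      base-invertible σ = ^≡1⇒invertible (base σ) (m ℕ.* 2) {{ℕ.m*n≢0 m 2}} (begin
        base σ ^ (m ℕ.* 2)   ≡⟨ ℤ.^-*-assoc (base σ) m 2 ⟨
        (base σ ^ m) ^ 2     ≈⟨ ^-cong 2 (base-^m σ q∣N) ⟩
        (σ ◃ 1) ^ 2          ≡⟨ ◃1-^2 σ ⟩
        1ℤ                   ∎)
        where open ≡-mod-Reasoning q

      fermat-cancel : ∀ {x u} → x ^ (N ℕ.∸ 1) ≡ 1ℤ mod q → (x * u) ^ (N ℕ.∸ 1) ≡ u ^ (N ℕ.∸ 1) mod q
      fermat-cancel {x} {u} x^[N-1]≡1 = begin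
        (x * u) ^ (N ℕ.∸ 1)                ≡⟨ ^-distribʳ-* x u (N ℕ.∸ 1) ⟩
        x ^ (N ℕ.∸ 1) * u ^ (N ℕ.∸ 1)      ≈⟨ *-congʳ (u ^ (N ℕ.∸ 1)) x^[N-1]≡1 ⟩
        1ℤ * u ^ (N ℕ.∸ 1)                 ≡⟨ ℤ.*-identityˡ _ ⟩
        u ^ (N ℕ.∸ 1)                      ∎
        where open ≡-mod-Reasoning q

      same-sign⇒same-choice : ∀ {a a' Y Y' σ k k' ε ε'} → (+ a) ^ m ≡ ε ◃ 1 mod N → (+ a') ^ m ≡ ε' ◃ 1 mod N →
                              Y ≡ target p σ k mod q → Y' ≡ target p σ k' mod q → + a * Y ≡ + a' * Y' mod q →
                              k < P → k' < P → k ≡ k' × (+ a ≡ + a' mod q)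
      same-sign⇒same-choice {a} {a'} {Y} {Y'} {σ} {k} {k'} a^m≡ε a'^m≡ε' Y≡target Y'≡target aY≡a'Y' k<P k'<P =
        k≡k' , *-cancelʳ-invertible (^≡1⇒invertible (principal p k) P (principal^P≡1 k)) au≡a'u
        where
        au≡a'u' : + a * principal p k ≡ + a' * principal p k' mod q
        au≡a'u' = *-cancelʳ-invertible (base-invertible σ) (begin
          + a * principal p k * base σ    ≡⟨ lemma (+ a) (principal p k) (base σ) ⟩
          + a * target p σ k              ≈⟨ *-congˡ (+ a) Y≡target ⟨
          + a * Y                         ≈⟨ aY≡a'Y' ⟩
          + a' * Y'                       ≈⟨ *-congˡ (+ a') Y'≡target ⟩
          + a' * target p σ k'            ≡⟨ lemma (+ a') (principal p k') (base σ) ⟨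
          + a' * principal p k' * base σ  ∎)
          where
          open ≡-mod-Reasoning q
          lemma : ∀ x u b → x * u * b ≡ x * (b * u)
          lemma = solve-∀
        u^[N-1]≡u'^[N-1] : principal p k ^ (N ℕ.∸ 1) ≡ principal p k' ^ (N ℕ.∸ 1) mod q
        u^[N-1]≡u'^[N-1] = begin
          principal p k ^ (N ℕ.∸ 1)             ≈⟨ fermat-cancel (≡-mod-∣ q∣N (^m≡±1⇒^[N-1]≡1 a^m≡ε)) ⟨
          (+ a * principal p k) ^ (N ℕ.∸ 1)     ≈⟨ ^-cong (N ℕ.∸ 1) au≡a'u' ⟩
          (+ a' * principal p k') ^ (N ℕ.∸ 1)   ≈⟨ fermat-cancel (≡-mod-∣ q∣N (^m≡±1⇒^[N-1]≡1 a'^m≡ε')) ⟩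
          principal p k' ^ (N ℕ.∸ 1)            ∎
          where open ≡-mod-Reasoning q
        k≡k' : k ≡ k'
        k≡k' = principal-injective {{prime⇒nonZero p-prime}} k<P k'<P
                 (rootOfUnity-^-injective N-1⊥P (principal^P≡1 k) (principal^P≡1 k') u^[N-1]≡u'^[N-1])
        au≡a'u : + a * principal p k ≡ + a' * principal p k mod q
        au≡a'u = subst (λ k″ → + a * principal p k ≡ + a' * principal p k″ mod q) (sym k≡k') au≡a'u'

      choice-agrees : ∀ {a a' Y Y' ε} {c c' : Choice (p , suc j)} →
                      (+ a) ^ m ≡ ε ◃ 1 mod N → (+ a') ^ m ≡ ε ◃ 1 mod N →
                      Y ≡ target p (proj₁ c) (toℕ (proj₂ c)) mod q →
                      Y' ≡ target p (proj₁ c') (toℕ (proj₂ c')) mod q →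
                      + a * Y ≡ + a' * Y' mod q → c ≡ c' × (+ a ≡ + a' mod q)
      choice-agrees {a} {a'} {Y} {Y'} {ε} {σ , k} {σ' , k'} a^m≡ε a'^m≡ε Y≡t Y'≡t' aY≡a'Y' =
        cong₂ _,_ σ≡σ' (toℕ-injective (proj₁ agree)) , proj₂ agree
        where
        σ≡σ' : σ ≡ σ'
        σ≡σ' = Sign.*-cancelˡ-≡ ε σ σ'
                 (signs-agree {σ = σ} {σ'} {toℕ k} {toℕ k'} a^m≡ε a'^m≡ε Y≡t Y'≡t' aY≡a'Y')
        Y'≡t'' : Y' ≡ target p σ (toℕ k') mod q
        Y'≡t'' = subst (λ τ → Y' ≡ target p τ (toℕ k') mod q) (sym σ≡σ') Y'≡t'
        agree : toℕ k ≡ toℕ k' × (+ a ≡ + a' mod q)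
        agree = same-sign⇒same-choice {σ = σ} {toℕ k} {toℕ k'} a^m≡ε a'^m≡ε Y≡t Y'≡t'' aY≡a'Y'
                                      (toℕ<n k) (toℕ<n k')

    data IsPrimePowerFactor : ℕ × ℕ → Set where
      primePowerFactor : ∀ {p j} → Prime p → p ℕ.^ suc j ℕ.∣ N → IsPrimePowerFactor (p , suc j)

    congruenceSystem : ∀ ps → All Choice ps → List (ℕ × ℤ)
    congruenceSystem []             []             = []
    congruenceSystem ((p , e) ∷ ps) ((σ , k) ∷ cs) = (p ℕ.^ e , target p σ (toℕ k)) ∷ congruenceSystem ps cs

    moduli-congruenceSystem : ∀ ps cs → map proj₁ (congruenceSystem ps cs) ≡ map primePower ps
    moduli-congruenceSystem []       []       = refl
    moduli-congruenceSystem (_ ∷ ps) (_ ∷ cs) = cong (_ ∷_) (moduli-congruenceSystem ps cs)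

    primePowerFactors : ∀ {ps} → All (λ pe → Prime (proj₁ pe)) ps → All (λ pe → 1 ≤ proj₂ pe) ps →
                        product (map primePower ps) ℕ.∣ N → All IsPrimePowerFactor ps
    primePowerFactors []                 []                     _     = []
    primePowerFactors {pe ∷ _} (p-prime ∷ primes) (ℕ.s≤s ℕ.z≤n ∷ exponents) q*M∣N =
      primePowerFactor p-prime (ℕ.∣-trans (ℕ.m∣m*n _) q*M∣N) ∷
      primePowerFactors primes exponents (ℕ.∣-trans (ℕ.n∣m*n (primePower pe)) q*M∣N)

    choices-agree : ∀ {ps} → All IsPrimePowerFactor ps → ∀ {cs cs' a a' Y Y' ε} →
                    (+ a) ^ m ≡ ε ◃ 1 mod N → (+ a') ^ m ≡ ε ◃ 1 mod N →
                    Y solves congruenceSystem ps cs → Y' solves congruenceSystem ps cs' →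
                    + a * Y ≡ + a' * Y' mod N → cs ≡ cs' × All (λ pe → + a ≡ + a' mod primePower pe) ps
    choices-agree [] {[]} {[]} _ _ _ _ _ = refl , []
    choices-agree (primePowerFactor {p} {j} p-prime q∣N ∷ factors) {_ ∷ _} {_ ∷ _} a^m≡ε a'^m≡ε
                  (Y≡t ∷ Y-solves) (Y'≡t' ∷ Y'-solves) aY≡a'Y' =
      let c≡c' , a≡a'[q] = AtPrimePower.choice-agrees p j p-prime q∣N a^m≡ε a'^m≡ε Y≡t Y'≡t'
                                                      (≡-mod-∣ q∣N aY≡a'Y')
          cs≡cs' , a≡a'[rest] = choices-agree factors a^m≡ε a'^m≡ε Y-solves Y'-solves aY≡a'Y'
      in cong₂ _∷_ c≡c' cs≡cs' , a≡a'[q] ∷ a≡a'[rest]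

    choiceCount : ℕ × ℕ → ℕ
    choiceCount pe = 2 ℕ.* proj₁ pe ℕ.^ (proj₂ pe ℕ.∸ 1)

    choices↣ : ∀ ps → Fin (product (map choiceCount ps)) ↣ All Choice ps
    choices↣ []       = Fin1↣All[]
    choices↣ (_ ∷ ps) =
      ×↣All∷ ↣-∘ ((((Fin2↣Sign ×-↣ ↣-id _) ↣-∘ ↔⇒↣ *↔×) ×-↣ choices↣ ps) ↣-∘ ↔⇒↣ *↔×)

    Liar : ℕ → Set
    Liar a = a < N × ∃ λ ε → (+ a) ^ m ≡ ε ◃ 1 mod N

    module Embedding {p₀ j₀ rest as} (p₀-prime : Prime p₀) (q₀∣N : p₀ ℕ.^ suc j₀ ℕ.∣ N)
                     (factors : All IsPrimePowerFactor rest)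
                     (pairwise : AllPairs Coprime (map primePower ((p₀ , suc j₀) ∷ rest)))
                     (product≡N : product (map primePower ((p₀ , suc j₀) ∷ rest)) ≡ N)
                     (distinct : AllPairs _≢_ as) (liars : All Liar as) where

      ps : List (ℕ × ℕ)
      ps = (p₀ , suc j₀) ∷ rest

      P₀ : ℕ
      P₀ = p₀ ℕ.^ j₀

      Domain : Set
      Domain = Fin (length as) × Fin P₀ × All Choice rest

      decoding : Fin (length as ℕ.* (P₀ ℕ.* product (map choiceCount rest))) ↣ Domain
      decoding = (↣-id _ ×-↣ ((↣-id _ ×-↣ choices↣ rest) ↣-∘ ↔⇒↣ *↔×)) ↣-∘ ↔⇒↣ *↔×

      system-pairwise : ∀ cs → AllPairs (Coprime on proj₁) (congruenceSystem ps cs)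
      system-pairwise cs = AllPairs.map⁻ (subst (AllPairs Coprime) (sym (moduli-congruenceSystem ps cs)) pairwise)

      solution : All Choice ps → ℤ
      solution cs = proj₁ (crt (congruenceSystem ps cs) (system-pairwise cs))

      solution-solves : ∀ cs → solution cs solves congruenceSystem ps cs
      solution-solves cs = proj₂ (crt (congruenceSystem ps cs) (system-pairwise cs))

      liar : ∀ i → Liar (lookup as i)
      liar i = All.lookup liars (∈-lookup i)

      sign : Fin (length as) → Sign
      sign i = proj₁ (proj₂ (liar i))

      -- Only the product of the sign of a^m and σ is visible modulo each p^e; fixing σ = + at the
      -- first prime makes the sign of a^m, and with it all other σ, recoverable.
      choices : Domain → All Choice ps
      choices (_ , k₀ , cs) = (Sign.+ , k₀) ∷ cs

      value : Domain → ℤ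
      value x@(i , _) = + lookup as i * solution (choices x)

      value≢0 : ∀ x → ¬ value x ≡ 0ℤ mod N
      value≢0 x@(i , k₀ , _) v≡0 =
        AtPrimePower.target-multiple≢0 p₀ j₀ p₀-prime q₀∣N {σ = Sign.+} {k = toℕ k₀}
          (proj₂ (proj₂ (liar i))) (All.head (solution-solves (choices x))) (≡-mod-∣ q₀∣N v≡0)

      embed : Domain → Fin (N ℕ.∸ 1)
      embed x = nonzeroResidue (value x) (value≢0 x)

      embed-injective : Injective _≡_ _≡_ embed
      embed-injective {x@(i , k₀ , _)} {x'@(i' , k₀' , _)} embed≡ =
        cong₂ _,_ i≡i' (cong₂ _,_ (cong (proj₂ ∘ All.head) choices≡) (cong All.tail choices≡))
        where
        aY≡a'Y' : value x ≡ value x' mod N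
        aY≡a'Y' = nonzeroResidue-injective (value≢0 x) (value≢0 x') embed≡
        a^m≡ε : (+ lookup as i) ^ m ≡ sign i ◃ 1 mod N
        a^m≡ε = proj₂ (proj₂ (liar i))
        ε≡ε' : sign i ≡ sign i'
        ε≡ε' = trans (sym (Sign.*-identityʳ (sign i))) (trans
                 (AtPrimePower.signs-agree p₀ j₀ p₀-prime q₀∣N {σ = Sign.+} {Sign.+} {toℕ k₀} {toℕ k₀'}
                    a^m≡ε (proj₂ (proj₂ (liar i'))) (All.head (solution-solves (choices x)))
                    (All.head (solution-solves (choices x'))) (≡-mod-∣ q₀∣N aY≡a'Y'))
                 (Sign.*-identityʳ (sign i')))
        a'^m≡ε : (+ lookup as i') ^ m ≡ sign i ◃ 1 mod N
        a'^m≡ε = subst (λ ε → (+ lookup as i') ^ m ≡ ε ◃ 1 mod N) (sym ε≡ε') (proj₂ (proj₂ (liar i')))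
        agree : choices x ≡ choices x' × All (λ pe → + lookup as i ≡ + lookup as i' mod primePower pe) ps
        agree = choices-agree (primePowerFactor p₀-prime q₀∣N ∷ factors) a^m≡ε a'^m≡ε
                  (solution-solves (choices x)) (solution-solves (choices x')) aY≡a'Y'
        choices≡ : choices x ≡ choices x'
        choices≡ = proj₁ agree
        a≡a' : + lookup as i ≡ + lookup as i' mod N
        a≡a' = subst (λ n → _ ≡ _ mod n) product≡N (≡-mod-product pairwise (All.map⁺ (proj₂ agree)))
        i≡i' : i ≡ i'
        i≡i' = lookup-injective distinct (≡-mod⇒≡ (proj₁ (liar i)) (proj₁ (liar i')) a≡a')

      embedding : Domain ↣ Fin (N ℕ.∸ 1)
      embedding = mk↣ embed-injective

    liars-bound : ∀ {pe rest as} → All IsPrimePowerFactor (pe ∷ rest) → AllPairs Coprime (map primePower (pe ∷ rest)) →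
                  product (map primePower (pe ∷ rest)) ≡ N → AllPairs _≢_ as → All Liar as →
                  length as ℕ.* (2 ℕ.^ length rest ℕ.* reducedProduct (pe ∷ rest)) ≤ N ℕ.∸ 1
    liars-bound {_} {rest} {as} (primePowerFactor {p₀} {j₀} p₀-prime q₀∣N ∷ factors) pairwise product≡N distinct liars =
      subst (_≤ N ℕ.∸ 1) |Domain|≡ (injective⇒≤ (Injection.injective (embedding ↣-∘ decoding)))
      where
      open Embedding {j₀ = j₀} p₀-prime q₀∣N factors pairwise product≡N distinct liars
      |Domain|≡ : length as ℕ.* (P₀ ℕ.* product (map choiceCount rest)) ≡
                  length as ℕ.* (2 ℕ.^ length rest ℕ.* (P₀ ℕ.* reducedProduct rest))
      |Domain|≡ = cong (length as ℕ.*_) (trans (cong (P₀ ℕ.*_) (product-map-2* _ rest)) (lemma P₀ (2 ℕ.^ length rest) _))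
        where
        lemma : ∀ a b c → a ℕ.* (b ℕ.* c) ≡ b ℕ.* (a ℕ.* c)
        lemma = ℕ-solve-∀

module MillerRabin (N s t : ℕ) .{{_ : NonZero N}} (N-odd : ¬ 2 ℕ.∣ N) (t-odd : ¬ 2 ℕ.∣ t)
                   (N-1≡2^s*t : N ℕ.∸ 1 ≡ 2 ℕ.^ s ℕ.* t) where

  open import Data.Nat.DivMod using (_%_; m%n<n)
  open import Data.Integer.Base using (ℤ; +_; _^_; 1ℤ; -1ℤ; _◃_)
  open import Relation.Binary.Definitions using (tri<; tri≈; tri>)
  import Data.List.Relation.Unary.Unique.Propositional.Properties as Unique
  open import Defs using (MRPrime; MRPrime?; bases)
  open Arithmetic using (2∣n⊎2∣1+n; 2^[1+i+d]*t; greatest-below)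
  open Congruence
  open Signs
  open Powers using (pos-^)

  %≡1⇒≡1 : ∀ b e → (b ℕ.^ e) % N ≡ 1 → (+ b) ^ e ≡ 1ℤ mod N
  %≡1⇒≡1 b e b^e%N≡1 = ≡-mod-trans (≡-mod-reflexive (sym (pos-^ b e))) (%≡⇒≡-mod b^e%N≡1)

  %≡N-1⇒≡-1 : ∀ b e → (b ℕ.^ e) % N ≡ N ℕ.∸ 1 → (+ b) ^ e ≡ -1ℤ mod N
  %≡N-1⇒≡-1 b e b^e%N≡N-1 =
    ≡-mod-trans (≡-mod-reflexive (sym (pos-^ b e))) (≡-mod-trans (%≡⇒≡-mod b^e%N≡N-1) (pred≡-1 N))

  N-1<N : N ℕ.∸ 1 < N
  N-1<N = ℕ.∸-monoʳ-< ℕ.z<s (ℕ.>-nonZero⁻¹ N)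

  0<s : 0 < s
  0<s = ℕ.n≢0⇒n>0 s≢0
    where
    2∣N-1 : 2 ℕ.∣ N ℕ.∸ 1
    2∣N-1 = [ (λ 2∣N-1 → 2∣N-1) , (λ 2∣N → ⊥-elim (N-odd (subst (2 ℕ.∣_) (ℕ.suc-pred N) 2∣N))) ]′
              (2∣n⊎2∣1+n (N ℕ.∸ 1))
    s≢0 : s ≢ 0
    s≢0 s≡0 = t-odd (subst (2 ℕ.∣_) N-1≡t 2∣N-1)
      where
      N-1≡t : N ℕ.∸ 1 ≡ t
      N-1≡t = trans (subst (λ s → N ℕ.∸ 1 ≡ 2 ℕ.^ s ℕ.* t) s≡0 N-1≡2^s*t) (ℕ.*-identityˡ t)

  HasMinusOneAt : ℕ → Set
  HasMinusOneAt i = ∃ λ b → b < N × (b ℕ.^ (2 ℕ.^ i ℕ.* t)) % N ≡ N ℕ.∸ 1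

  hasMinusOneAt? : Decidable HasMinusOneAt
  hasMinusOneAt? i = ℕ.anyUpTo? (λ b → (b ℕ.^ (2 ℕ.^ i ℕ.* t)) % N ℕ.≟ N ℕ.∸ 1) N

  hasMinusOneAt-0 : HasMinusOneAt 0
  hasMinusOneAt-0 = N ℕ.∸ 1 , N-1<N , ≡-mod⇒≡ (m%n<n _ N) N-1<N (begin
    + ((N ℕ.∸ 1) ℕ.^ (1 ℕ.* t) % N)   ≈⟨ %≡⇒≡-mod refl ⟨
    + ((N ℕ.∸ 1) ℕ.^ (1 ℕ.* t))       ≡⟨ pos-^ (N ℕ.∸ 1) (1 ℕ.* t) ⟩
    (+ (N ℕ.∸ 1)) ^ (1 ℕ.* t)         ≈⟨ ^-cong (1 ℕ.* t) (pred≡-1 N) ⟩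
    -1ℤ ^ (1 ℕ.* t)                   ≡⟨ ◃1-^-odd Sign.- (subst (λ n → ¬ 2 ℕ.∣ n) t≡1*t t-odd) ⟩
    -1ℤ                               ≈⟨ pred≡-1 N ⟨
    + (N ℕ.∸ 1)                       ∎)
    where
    open ≡-mod-Reasoning N
    t≡1*t : t ≡ 1 ℕ.* t
    t≡1*t = sym (ℕ.*-identityˡ t)

  liars : List ℕ
  liars = filter (MRPrime? N s t) (bases N)

  liars-distinct : AllPairs _≢_ liars
  liars-distinct = Unique.filter⁺ (MRPrime? N s t) (Unique.map⁺ ℕ.suc-injective (Unique.upTo⁺ (N ℕ.∸ 1)))

  liars-below-N : All (λ a → a < N × MRPrime N s t a) liars
  liars-below-N = All.tabulate λ a∈liars →
    let a∈bases , liar = ∈-filter⁻ (MRPrime? N s t) a∈liars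
        _ , j∈upTo , a≡1+j = ∈-map⁻ suc a∈bases
    in subst (_< N) (sym a≡1+j) (ℕ.≤-<-trans (∈-upTo⁻ j∈upTo) N-1<N) , liar

  greatestMinusOne : ∃ λ k → k < s × HasMinusOneAt k × (∀ {j} → k < j → j < s → ¬ HasMinusOneAt j)
  greatestMinusOne = greatest-below hasMinusOneAt? 0<s hasMinusOneAt-0

  module AtGreatest {k : ℕ} (k<s : k < s) (hasMinusOneAt-k : HasMinusOneAt k)
                    (greatest : ∀ {j} → k < j → j < s → ¬ HasMinusOneAt j) where

    m : ℕ
    m = 2 ℕ.^ k ℕ.* t

    instance
      m≢0 : NonZero m
      m≢0 = ℕ.m*n≢0 (2 ℕ.^ k) t {{ℕ.m^n≢0 2 k}} {{ℕ.≢-nonZero t≢0}}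
        where
        t≢0 : t ≢ 0
        t≢0 t≡0 = t-odd (subst (2 ℕ.∣_) (sym t≡0) (2 ℕ.∣0))

    m*2∣N-1 : m ℕ.* 2 ℕ.∣ N ℕ.∸ 1
    m*2∣N-1 = ℕ.divides (2 ℕ.^ d) (begin
      N ℕ.∸ 1                   ≡⟨ N-1≡2^s*t ⟩
      2 ℕ.^ s ℕ.* t             ≡⟨ cong (λ e → 2 ℕ.^ e ℕ.* t) (ℕ.m+[n∸m]≡n k<s) ⟨
      2 ℕ.^ (suc k ℕ.+ d) ℕ.* t ≡⟨ 2^[1+i+d]*t k d t ⟩
      m ℕ.* 2 ℕ.* 2 ℕ.^ d       ≡⟨ ℕ.*-comm (m ℕ.* 2) _ ⟩
      2 ℕ.^ d ℕ.* (m ℕ.* 2)     ∎)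
      where
      open ≡-Reasoning
      d : ℕ
      d = s ℕ.∸ suc k

    B : ℤ
    B = + proj₁ hasMinusOneAt-k

    B^m≡-1 : B ^ m ≡ -1ℤ mod N
    B^m≡-1 = %≡N-1⇒≡-1 _ m (proj₂ (proj₂ hasMinusOneAt-k))

    liar⇒^m≡±1 : ∀ {a} → a < N → MRPrime N s t a → ∃ λ ε → (+ a) ^ m ≡ ε ◃ 1 mod N
    liar⇒^m≡±1 {a} _ (inj₁ a^t%N≡1) = Sign.+ , (begin
      (+ a) ^ (2 ℕ.^ k ℕ.* t)   ≡⟨ cong ((+ a) ^_) (ℕ.*-comm (2 ℕ.^ k) t) ⟩
      (+ a) ^ (t ℕ.* 2 ℕ.^ k)   ≡⟨ ℤ.^-*-assoc (+ a) t (2 ℕ.^ k) ⟨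
      ((+ a) ^ t) ^ 2 ℕ.^ k     ≈⟨ ^-cong (2 ℕ.^ k) (%≡1⇒≡1 a t a^t%N≡1) ⟩
      1ℤ ^ 2 ℕ.^ k              ≡⟨ ℤ.^-zeroˡ (2 ℕ.^ k) ⟩
      1ℤ                        ∎)
      where open ≡-mod-Reasoning N
    liar⇒^m≡±1 {a} a<N (inj₂ (i , i<s , a^[2^i*t]%N≡N-1)) with ℕ.<-cmp i k
    ... | tri≈ _ refl _ = Sign.- , %≡N-1⇒≡-1 a (2 ℕ.^ i ℕ.* t) a^[2^i*t]%N≡N-1
    ... | tri> _ _ k<i  = ⊥-elim (greatest k<i i<s (a , a<N , a^[2^i*t]%N≡N-1))
    ... | tri< i<k _ _  = Sign.+ , (begin
      (+ a) ^ m                                  ≡⟨ cong (λ e → (+ a) ^ (2 ℕ.^ e ℕ.* t)) (ℕ.m+[n∸m]≡n i<k) ⟨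
      (+ a) ^ (2 ℕ.^ (suc i ℕ.+ d) ℕ.* t)        ≡⟨ cong ((+ a) ^_) (2^[1+i+d]*t i d t) ⟩
      (+ a) ^ (2 ℕ.^ i ℕ.* t ℕ.* 2 ℕ.* 2 ℕ.^ d)   ≡⟨ ℤ.^-*-assoc (+ a) (2 ℕ.^ i ℕ.* t ℕ.* 2) (2 ℕ.^ d) ⟨
      ((+ a) ^ (2 ℕ.^ i ℕ.* t ℕ.* 2)) ^ 2 ℕ.^ d  ≡⟨ cong (_^ 2 ℕ.^ d) (ℤ.^-*-assoc (+ a) (2 ℕ.^ i ℕ.* t) 2) ⟨
      (((+ a) ^ (2 ℕ.^ i ℕ.* t)) ^ 2) ^ 2 ℕ.^ d  ≈⟨ ^-cong (2 ℕ.^ d) (^-cong 2 a^[2^i*t]≡-1) ⟩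
      (-1ℤ ^ 2) ^ 2 ℕ.^ d                        ≡⟨ ◃1-^-even Sign.- (2 ℕ.^ d) ⟩
      1ℤ                                         ∎)
      where
      open ≡-mod-Reasoning N
      d : ℕ
      d = k ℕ.∸ suc i
      a^[2^i*t]≡-1 : (+ a) ^ (2 ℕ.^ i ℕ.* t) ≡ -1ℤ mod N
      a^[2^i*t]≡-1 = %≡N-1⇒≡-1 a (2 ℕ.^ i ℕ.* t) a^[2^i*t]%N≡N-1

open import Defs
open import Data.Nat using (ℕ; suc; _*_; _∸_; _^_; _≤_; NonZero)
open import Data.Nat.Divisibility using (_∣_)
open import Data.Nat.Primality using (Prime; Composite; ¬composite[1])
open import Data.Product using (_×_; proj₁; proj₂)
open import Data.List using (List; length; map)
open import Data.List.Relation.Unary.All using (All)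
open import Data.List.Relation.Unary.AllPairs using (AllPairs)
open import Relation.Binary.PropositionalEquality using (_≡_; _≢_)
open import Relation.Nullary using (¬_)

lemma5p1 : (N : ℕ) → .{{_ : NonZero N}} → ¬ (2 ∣ N) → Composite N →
           (ps : List (ℕ × ℕ)) →
           All (λ pe → Prime (proj₁ pe)) ps →
           All (λ pe → 1 ≤ proj₂ pe) ps →
           AllPairs _≢_ (map proj₁ ps) →
           primePowerProduct ps ≡ N →
           (s t : ℕ) → ¬ (2 ∣ t) → N ∸ 1 ≡ 2 ^ s * t →
           #liars N s t * (2 ^ (length ps ∸ 1) * reducedProduct ps) ≤ N ∸ 1
lemma5p1 N _ composite [] _ _ _ 1≡N _ _ _ _ = ⊥-elim (¬composite[1] (subst Composite (sym 1≡N) composite))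
lemma5p1 N N-odd _ (_ ∷ _) primes exponents distinct product≡N s t t-odd N-1≡2^s*t =
  liars-bound (primePowerFactors primes exponents (ℕ.∣-reflexive product≡N))
              (distinct-prime-powers-coprime primes distinct) product≡N liars-distinct
              (All.map (λ (a<N , liar) → a<N , liar⇒^m≡±1 a<N liar) liars-below-N)
  where
  open Coprimality using (distinct-prime-powers-coprime)
  open MillerRabin N s t N-odd t-odd N-1≡2^s*t
  open AtGreatest (proj₁ (proj₂ greatestMinusOne)) (proj₁ (proj₂ (proj₂ greatestMinusOne)))
                  (proj₂ (proj₂ (proj₂ greatestMinusOne)))
  open Counting.LiarCount N m N-odd m*2∣N-1 B B^m≡-1
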